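{- Let $n \geq 4$ be an integer and let $q$ be a positive integer. In the $(q:1)$ Waiter-Client game on $E(K_n)$, Waiter has a strategy to force Client's graph at the end of the game to be a connected graph on all $n$ vertices of $K_n$ if and only if $q \leq \lfloor n/2 \rfloor - 1$.
   Context: The $(q:1)$ Waiter-Client game on $E(K_n)$ (for a positive integer $q$) is the following two-player perfect information game. In each round, Waiter offers Client exactly $q+1$ edges of the complete graph $K_n$ which have not been claimed before; Client chooses one of these edges, which he keeps, and the remaining $q$ edges are claimed by Waiter. If fewer than $q+1$ unclaimed edges remain, all of them are claimed by Waiter. The game ends when all edges of $K_n$ have been claimed. Client's graph is the graph with vertex set $V(K_n)$ whose edges are all the edges claimed by Client. -}

module Defs where

open import Data.Fin using (Fin; _<?_)
open import Data.List using (List; []; _∷_; _++_; length; filter; allFin; cartesianProduct)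
open import Data.List.Membership.Propositional using (_∈_)
open import Data.List.Relation.Binary.Permutation.Propositional using (_↭_)
open import Data.Nat using (ℕ; suc; _<_)
open import Data.Product using (_×_; _,_; ∃-syntax; uncurry)
open import Relation.Binary.Construct.Closure.Equivalence using (EqClosure)
open import Relation.Binary.PropositionalEquality using (_≡_)

-- The unordered edge {u , v} is stored once, as the pair (u , v) with u < v.
Edge : ℕ → Set
Edge n = Fin n × Fin n

Graph : ℕ → Set
Graph n = List (Edge n)

K : (n : ℕ) → Graph n
K n = filter (uncurry _<?_) (cartesianProduct (allFin n) (allFin n))

-- An element of the equivalence closure is a walk from u to v traversing
-- edges of G in either direction.
Connected : ∀ {n} → Graph n → Set
Connected {n} G = (u v : Fin n) → EqClosure (λ x y → (x , y) ∈ G) u v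

private
  variable
    n q : ℕ
    e : Edge n
    free offered rest G : List (Edge n)

-- A strategy for Waiter in the (q : 1) game, from a position whose list of
-- unclaimed edges is `free`.  It is a tree branching over Client's answers, so
-- Waiter's offers may depend on the whole history of play.  The edges in `free`
-- are pairwise distinct, so the permutation says that `offered` is a set of
-- unclaimed edges and `rest` consists of the other unclaimed ones.
data Strategy {n : ℕ} (q : ℕ) (free : List (Edge n)) : Set where
  end   : length free < suc q → Strategy q free
  offer : (offered rest : List (Edge n)) →
          length offered ≡ suc q →
          free ↭ offered ++ rest →
          (∀ {e} → e ∈ offered → Strategy q rest) →
          Strategy q free

-- `Play s G`: against the strategy s, Client can answer in such a way that the
-- edges he claims from this position until the end of the game are those of G.
data Play {n q : ℕ} : {free : List (Edge n)} → Strategy q free → Graph n → Set where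
  end    : (few : length free < suc q) → Play {free = free} (end few) []
  choose : {size  : length offered ≡ suc q}
           {split : free ↭ offered ++ rest}
           {next  : ∀ {e} → e ∈ offered → Strategy q rest}
           (c : e ∈ offered) →
           Play (next c) G →
           Play (offer offered rest size split next) (e ∷ G)

WaiterCanForce : (n q : ℕ) → (Graph n → Set) → Set
WaiterCanForce n q P = ∃[ s ] (∀ {G} → Play {q = q} {free = K n} s G → P G)

{-# OPTIONS --safe #-}

-- Let k = q + 1.  If Waiter wins, then Client gets at least n ∸ 1 edges, one out
-- of each k offered, so k (n ∸ 1) ≤ n (n ∸ 1) / 2 and hence k ≤ n / 2.
--
-- Conversely, let 2 k ≤ n.  Waiter only offers edges between the component M of
-- a root and the vertices outside M.  Give an outside vertex as weight the number
-- of unclaimed edges between it and M.  Waiter selects a set X of outside vertices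
-- of total weight at least k and offers k of their edges to M; Client thereby moves
-- some x ∈ X to M.  Discarding what is left of the other edges between M and X, the
-- vertices of X other than x restart with weight 1, their edge to x, and those
-- outside X gain 1: up to names, the new position does not depend on Client's
-- choice.  At the start of round t ≤ k there are (apart from vertices to be treated
-- at the very end) k − t + 1 vertices of weight t, k − t of weight 1, and
-- a chain of t − 1 vertices of weights t − 1, ..., 1.  For X Waiter takes one vertex
-- of weight t and all the k − t of weight 1; one of the restarted ones extends the
-- chain.  After k − 1 rounds the weights are k, k − 1, ..., 1, and from then on
-- Waiter offers k edges at the first vertex of the chain, again and again.
module Submission where

open import Defs
import Algebra.Solver.CommutativeMonoid as CommutativeMonoidSolver
open import Data.Fin using (Fin; zero; suc; punchIn; punchOut; _<?_)
  renaming (_<_ to _<ᶠ_)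
open import Data.Fin.Properties
  using (<-cmp; _≟_; punchOut-punchIn; punchOut-cong; punchInᵢ≢i)
open import Data.List
  using (List; []; _∷_; [_]; _++_; length; map; concatMap; filter; take; drop; tabulate; allFin; cartesianProduct)
open import Data.List.Membership.Propositional using (_∈_; find)
open import Data.List.Membership.Propositional.Properties
  using (∈-∃++; ∈-concatMap⁻; ∈-tabulate⁺; ∈-++⁺ˡ; ∈-++⁺ʳ)
open import Data.List.Properties
  using (length-++; length-map; length-take; length-drop; length-tabulate; take++drop≡id;
         filter-++; filter-all; filter-reject; concatMap-++; map-++; map-∘; map-id; ++-assoc; ++-identityʳ)
open import Data.List.Relation.Binary.Permutation.Propositional
  using (_↭_; ↭-refl; ↭-sym; ↭-trans; ↭-reflexive; prep; swap; module PermutationReasoning)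
import Data.List.Relation.Binary.Permutation.Propositional as Perm
open import Data.List.Relation.Binary.Permutation.Propositional.Properties
  using (All-resp-↭; ∈-resp-↭; ↭-length; shift; ++⁺; ++⁺ˡ; ++⁺ʳ; ++-commutativeMonoid; shifts)
  renaming (map⁺ to ↭-map⁺)
open import Data.List.Relation.Binary.Subset.Propositional using (_⊆_)
open import Data.List.Relation.Unary.All as All using (All; []; _∷_)
import Data.List.Relation.Unary.All.Properties as All
open import Data.List.Relation.Unary.AllPairs using (AllPairs; []; _∷_)
import Data.List.Relation.Unary.AllPairs.Properties as AllPairs
open import Data.List.Relation.Unary.Any using (here; there)
open import Data.Nat
  using (ℕ; zero; suc; _+_; _*_; _∸_; _≤_; _<_; z≤n; s≤s; z<s; ⌊_/2⌋; ⌈_/2⌉; pred)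
open import Data.Nat.Induction using (<-wellFounded)
open import Data.Nat.Properties hiding (<-cmp; _≟_; _<?_)
open import Data.Nat.Solver using (module +-*-Solver)
open import Data.Product as Product using (_×_; _,_; ∃-syntax; Σ-syntax; proj₁; proj₂; uncurry)
open import Data.Sum as Sum using (_⊎_; inj₁; inj₂)
open import Data.Unit using (⊤; tt)
open import Function using (_∘_; id)
open import Function.Bundles using (_⇔_; mk⇔)
open import Induction.WellFounded using (Acc; acc)
open import Relation.Binary.Construct.Closure.Equivalence as EqC using (EqClosure)
open import Relation.Binary.Construct.Closure.ReflexiveTransitive using (ε; _◅_; _◅◅_)
open import Relation.Binary.Construct.Closure.Symmetric using (fwd; bwd)
open import Relation.Binary.Definitions using (tri<; tri≈; tri>)
open import Relation.Binary.PropositionalEquality hiding ([_])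
open import Relation.Nullary using (¬_; yes; no; contradiction)

private
  variable
    n : ℕ

-- Walks, and complete graphs on lists of vertices.

Joined : Graph n → Fin n → Fin n → Set
Joined G = EqClosure (λ x y → (x , y) ∈ G)

Joined-mono : {G H : Graph n} → G ⊆ H → ∀ {u v} → Joined G u v → Joined H u v
Joined-mono G⊆H = EqC.map G⊆H

-- Waiter's strategy meets vertices in no particular order, while `K` stores increasing pairs.
edge : Fin n → Fin n → Edge n
edge x y with x <? y
... | yes _ = x , y
... | no  _ = y , x

edge-< : {x y : Fin n} → x <ᶠ y → edge x y ≡ (x , y)
edge-< {x = x} {y} x<y with x <? y
... | yes _   = refl
... | no x≮y = contradiction x<y x≮y

edge-≮ : {x y : Fin n} → ¬ x <ᶠ y → edge x y ≡ (y , x)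
edge-≮ {x = x} {y} x≮y with x <? y
... | yes x<y = contradiction x<y x≮y
... | no _    = refl

edge-comm : (x y : Fin n) → edge x y ≡ edge y x
edge-comm x y with <-cmp x y
... | tri< x<y _ y≮x   = trans (edge-< x<y) (sym (edge-≮ y≮x))
... | tri≈ _ refl _    = refl
... | tri> x≮y _ y<x   = trans (edge-≮ x≮y) (sym (edge-< y<x))

edge-joins : {G : Graph n} (x y : Fin n) → edge x y ∈ G → Joined G x y
edge-joins x y xy∈G with x <? y
... | yes _ = fwd xy∈G ◅ ε
... | no  _ = bwd xy∈G ◅ ε

-- Splitting off the first vertex exposes its star: that is how the edges of a vertex are
-- reclassified once it joins the component of the root.
clique : List (Fin n) → Graph n
clique []       = []
clique (x ∷ xs) = map (edge x) xs ++ clique xs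

clique-↭ : {xs ys : List (Fin n)} → xs ↭ ys → clique xs ↭ clique ys
clique-↭ Perm.refl = ↭-refl
clique-↭ (prep x xs↭ys) = ++⁺ (↭-map⁺ (edge x) xs↭ys) (clique-↭ xs↭ys)
clique-↭ {xs = _ ∷ _ ∷ xs} {ys = _ ∷ _ ∷ ys} (swap x y xs↭ys) = begin
  edge x y ∷ map (edge x) xs ++ map (edge y) xs ++ clique xs
    ≡⟨ cong (_∷ map (edge x) xs ++ map (edge y) xs ++ clique xs) (edge-comm x y) ⟩
  edge y x ∷ map (edge x) xs ++ map (edge y) xs ++ clique xs
    ↭⟨ prep _ (shifts (map (edge x) xs) (map (edge y) xs)) ⟩
  edge y x ∷ map (edge y) xs ++ map (edge x) xs ++ clique xs
    ↭⟨ prep _ (++⁺ (↭-map⁺ (edge y) xs↭ys) (++⁺ (↭-map⁺ (edge x) xs↭ys) (clique-↭ xs↭ys))) ⟩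
  edge y x ∷ map (edge y) ys ++ map (edge x) ys ++ clique ys ∎
  where open PermutationReasoning
clique-↭ (Perm.trans xs↭ys ys↭zs) = ↭-trans (clique-↭ xs↭ys) (clique-↭ ys↭zs)

map-edge : {x : Fin n} {xs : List (Fin n)} → All (x <ᶠ_) xs → map (edge x) xs ≡ map (x ,_) xs
map-edge []           = refl
map-edge (x<y ∷ x<ys) = cong₂ _∷_ (edge-< x<y) (map-edge x<ys)

increasing : List (Edge n) → List (Edge n)
increasing = filter (uncurry _<?_)

-- The filter rejects every pair `(y , x)` with `x` below `y`. Dropping this column turns the square
-- product into the recursion of `clique`.
increasing-drop : {x : Fin n} (xs : List (Fin n)) {ys : List (Fin n)} → All (x <ᶠ_) ys →
  increasing (cartesianProduct ys (x ∷ xs)) ≡ increasing (cartesianProduct ys xs)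
increasing-drop xs [] = refl
increasing-drop {x = x} xs {y ∷ ys} (x<y ∷ x<ys) = begin
  increasing (map (y ,_) (x ∷ xs) ++ cartesianProduct ys (x ∷ xs))
    ≡⟨ filter-++ (uncurry _<?_) (map (y ,_) (x ∷ xs)) _ ⟩
  increasing (map (y ,_) (x ∷ xs)) ++ increasing (cartesianProduct ys (x ∷ xs))
    ≡⟨ cong₂ _++_ (filter-reject (uncurry _<?_) (<-asym x<y)) (increasing-drop xs x<ys) ⟩
  increasing (map (y ,_) xs) ++ increasing (cartesianProduct ys xs)
    ≡⟨ filter-++ (uncurry _<?_) (map (y ,_) xs) _ ⟨
  increasing (map (y ,_) xs ++ cartesianProduct ys xs) ∎
  where open ≡-Reasoning

increasing-clique : {xs : List (Fin n)} → AllPairs _<ᶠ_ xs →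
  increasing (cartesianProduct xs xs) ≡ clique xs
increasing-clique [] = refl
increasing-clique {xs = x ∷ xs} (x<xs ∷ sorted) = begin
  increasing (map (x ,_) (x ∷ xs) ++ cartesianProduct xs (x ∷ xs))
    ≡⟨ filter-++ (uncurry _<?_) (map (x ,_) (x ∷ xs)) _ ⟩
  increasing (map (x ,_) (x ∷ xs)) ++ increasing (cartesianProduct xs (x ∷ xs))
    ≡⟨ cong₂ _++_ (filter-reject (uncurry _<?_) {x , x} {map (x ,_) xs} (<-irrefl refl)) (increasing-drop xs x<xs) ⟩
  increasing (map (x ,_) xs) ++ increasing (cartesianProduct xs xs)
    ≡⟨ cong₂ _++_ (filter-all (uncurry _<?_) (All.map⁺ x<xs)) (increasing-clique sorted) ⟩
  map (x ,_) xs ++ clique xs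
    ≡⟨ cong (_++ clique xs) (map-edge x<xs) ⟨
  map (edge x) xs ++ clique xs ∎
  where open ≡-Reasoning

K≡clique : ∀ n → K n ≡ clique (allFin n)
K≡clique n = increasing-clique (AllPairs.tabulate⁺-< id)

length-clique : (xs : List (Fin n)) → 2 * length (clique xs) + length xs ≡ length xs * length xs
length-clique [] = refl
length-clique (x ∷ xs) = begin
  2 * length (map (edge x) xs ++ clique xs) + suc m
    ≡⟨ cong (λ l → 2 * l + suc m) (trans (length-++ (map (edge x) xs)) (cong (_+ c) (length-map (edge x) xs))) ⟩
  2 * (m + c) + suc m
    ≡⟨ lemma₁ m c ⟩
  (2 * c + m) + (1 + 2 * m)
    ≡⟨ cong (_+ (1 + 2 * m)) (length-clique xs) ⟩
  m * m + (1 + 2 * m)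
    ≡⟨ lemma₂ m ⟩
  suc m * suc m ∎
  where
  open ≡-Reasoning
  open +-*-Solver using (_:+_; _:*_; con; _:=_) renaming (solve to solveℕ)
  m = length xs
  c = length (clique xs)
  lemma₁ : ∀ m c → 2 * (m + c) + suc m ≡ (2 * c + m) + (1 + 2 * m)
  lemma₁ = solveℕ 2 (λ m c → con 2 :* (m :+ c) :+ (con 1 :+ m) := (con 2 :* c :+ m) :+ (con 1 :+ con 2 :* m)) refl
  lemma₂ : ∀ m → m * m + (1 + 2 * m) ≡ suc m * suc m
  lemma₂ = solveℕ 1 (λ m → m :* m :+ (con 1 :+ con 2 :* m) := (con 1 :+ m) :* (con 1 :+ m)) refl

length-K : ∀ m → 2 * length (K (suc m)) ≡ m * suc m
length-K m = +-cancelʳ-≡ (suc m) _ _ (begin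
  2 * length (K (suc m)) + suc m
    ≡⟨ cong₂ (λ G l → 2 * length G + l) (K≡clique (suc m)) (sym len) ⟩
  2 * length (clique vs) + length vs
    ≡⟨ length-clique vs ⟩
  length vs * length vs
    ≡⟨ cong₂ _*_ len len ⟩
  suc m * suc m
    ≡⟨ +-comm (suc m) (m * suc m) ⟩
  m * suc m + suc m ∎)
  where
  open ≡-Reasoning
  vs = allFin (suc m)
  len : length vs ≡ suc m
  len = length-tabulate id

-- Counting edges

-- The quotient map that identifies `a` with `b`: index `a` is removed, and `a` itself is sent where
-- `b` goes.
merge : ∀ {m} {a b : Fin (suc m)} → a ≢ b → Fin (suc m) → Fin m
merge {a = a} a≢b i with a ≟ i
... | yes _   = punchOut a≢b
... | no  a≢i = punchOut a≢i

merge-≡ : ∀ {m} {a b : Fin (suc m)} (a≢b : a ≢ b) → merge a≢b a ≡ merge a≢b b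
merge-≡ {a = a} {b} a≢b with a ≟ a | a ≟ b
... | no a≢a | _       = contradiction refl a≢a
... | yes _  | yes a≡b = contradiction a≡b a≢b
... | yes _  | no _    = punchOut-cong a refl

merge-surjective : ∀ {m} {a b : Fin (suc m)} (a≢b : a ≢ b) → ∀ j → merge a≢b (punchIn a j) ≡ j
merge-surjective {a = a} a≢b j with a ≟ punchIn a j
... | yes a≡ = contradiction (sym a≡) (punchInᵢ≢i a j)
... | no a≢  = trans (punchOut-cong a refl) (punchOut-punchIn a)

-- The labels stand for components. Adding an edge merges at most two labels into one, which is what
-- keeps `bound` true.
record Labelling (G : Graph n) : Set where
  field
    {size}  : ℕ
    bound   : n ≤ length G + size
    label   : Fin n → Fin size
    onto    : ∀ i → ∃[ v ] label v ≡ i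
    respect : ∀ {x y} → (x , y) ∈ G → label x ≡ label y

labelling : (G : Graph n) → Labelling G
labelling [] = record { bound = ≤-refl ; label = id ; onto = λ i → i , refl ; respect = λ () }
labelling {n = n} ((x , y) ∷ G) = extend size label bound onto respect
  where
  open Labelling (labelling G)
  -- The number of labels is passed as a variable so that it can be split into zero and successor.
  extend : ∀ m (f : Fin n → Fin m) → n ≤ length G + m → (∀ i → ∃[ v ] f v ≡ i) →
           (∀ {x y} → (x , y) ∈ G → f x ≡ f y) → Labelling ((x , y) ∷ G)
  extend m f n≤ onto resp with f x ≟ f y
  ... | yes fx≡fy = record
    { bound = m≤n⇒m≤1+n n≤ ; label = f ; onto = onto
    ; respect = λ { (here refl) → fx≡fy ; (there e∈G) → resp e∈G } }
  extend zero f n≤ onto resp | no _ with () ← f x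
  extend (suc m) f n≤ onto resp | no fx≢fy = record
    { bound   = ≤-trans n≤ (≤-reflexive (+-suc (length G) m))
    ; label   = merge fx≢fy ∘ f
    ; onto    = λ i → let v , fv≡ = onto (punchIn (f x) i) in
                v , trans (cong (merge fx≢fy) fv≡) (merge-surjective fx≢fy i)
    ; respect = λ { (here refl) → merge-≡ fx≢fy ; (there e∈G) → cong (merge fx≢fy) (resp e∈G) } }

-- Labels are constant along walks, so a connected graph cannot carry two of them; with at most one
-- label, `bound` gives the claim.
connected⇒edges : {G : Graph n} → Connected G → n ≤ suc (length G)
connected⇒edges {n = n} {G = G} conn = go size label bound onto respect
  where
  open Labelling (labelling G)
  go : ∀ m (f : Fin n → Fin m) → n ≤ length G + m → (∀ i → ∃[ v ] f v ≡ i) →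
       (∀ {x y} → (x , y) ∈ G → f x ≡ f y) → n ≤ suc (length G)
  go zero    f n≤ onto resp = ≤-trans n≤ (≤-trans (+-monoʳ-≤ (length G) z≤n) (≤-reflexive (+-comm (length G) 1)))
  go (suc zero) f n≤ onto resp = ≤-trans n≤ (≤-reflexive (+-comm (length G) 1))
  go (suc (suc m)) f n≤ onto resp
    with u , fu≡0 ← onto zero | v , fv≡1 ← onto (suc zero)
    with () ← trans (sym fu≡0) (trans (EqC.gfold isEquivalence f resp (conn u v)) fv≡1)

-- Client always takes the first edge offered. Each round uses up `suc q` edges and gives Client
-- one, so any other answers would obey the same bound; one play is enough to test Waiter's
-- strategy.
short-play : ∀ {q} {free : Graph n} (s : Strategy q free) →
  ∃[ G ] Play s G × suc q * length G ≤ length free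
short-play {q = q} (end few) = [] , end few , ≤-trans (≤-reflexive (*-zeroʳ (suc q))) z≤n
short-play {q = q} {free} (offer (e ∷ offered) rest size split next)
  with G , p , bound ← short-play (next (here refl))
  = e ∷ G , choose (here refl) p , (begin
    suc q * suc (length G)                   ≡⟨ *-suc (suc q) (length G) ⟩
    suc q + suc q * length G                 ≤⟨ +-monoʳ-≤ (suc q) bound ⟩
    suc q + length rest                      ≡⟨ cong (_+ length rest) size ⟨
    length (e ∷ offered) + length rest       ≡⟨ length-++ (e ∷ offered) ⟨
    length (e ∷ offered ++ rest)             ≡⟨ ↭-length split ⟨
    length free                              ∎)
  where open ≤-Reasoning

connected⇒2k≤n : ∀ {q} m → WaiterCanForce (suc (suc m)) q Connected → 2 * suc q ≤ suc (suc m)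
connected⇒2k≤n {q} m (s , wins)
  with G , p , bound ← short-play s
  -- The cancelled factor n - 1 is `suc m`, visibly positive.
  = *-cancelʳ-≤ (2 * suc q) (suc (suc m)) (suc m) (begin
    2 * suc q * suc m             ≤⟨ *-monoʳ-≤ (2 * suc q) (≤-pred (connected⇒edges (wins p))) ⟩
    2 * suc q * length G          ≡⟨ *-assoc 2 (suc q) (length G) ⟩
    2 * (suc q * length G)        ≤⟨ *-monoʳ-≤ 2 bound ⟩
    2 * length (K (suc (suc m)))  ≡⟨ length-K (suc m) ⟩
    suc m * suc (suc m)           ≡⟨ *-comm (suc m) (suc (suc m)) ⟩
    suc (suc m) * suc m           ∎)
  where open ≤-Reasoning

-- Waiter's strategy

Forces : (q : ℕ) → Graph n → (Graph n → Set) → Set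
Forces q free P = Σ[ s ∈ Strategy q free ] (∀ {G} → Play s G → P G)

-- Once Client's graph is connected, Waiter must still play to the end, and any offers will do. The
-- recursion is on the number of unclaimed edges, since `drop` is not structurally smaller.
some-strategy : ∀ q (free : Graph n) → Strategy q free
some-strategy q free = go free (<-wellFounded (length free))
  where
  go : ∀ free → Acc _<_ (length free) → Strategy q free
  go free (acc rec) with <-≤-connex (length free) (suc q)
  ... | inj₁ few    = end few
  ... | inj₂ enough =
    offer (take (suc q) free) (drop (suc q) free)
      (trans (length-take (suc q) free) (m≤n⇒m⊓n≡m enough))
      (↭-reflexive (sym (take++drop≡id (suc q) free)))
      λ _ → go (drop (suc q) free) (rec shorter)
    where
    shorter : length (drop (suc q) free) < length free
    shorter rewrite length-drop (suc q) free = ∸-monoʳ-< z<s enough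

offer-forces : ∀ {q} {free : Graph n} {P : Graph n → Set} (offered rest : Graph n) →
  length offered ≡ suc q → free ↭ offered ++ rest →
  (∀ {e} → e ∈ offered → Forces q rest (λ G → P (e ∷ G))) → Forces q free P
offer-forces offered rest size split next =
  offer offered rest size split (λ c → proj₁ (next c)) , λ { (choose c p) → proj₂ (next c) p }

-- `F` consists of the edges which Client already has.
Wins : ℕ → Graph n → Graph n → Set
Wins q F free = Forces q free (λ G → Connected (G ++ F))

-- A vertex outside the component of the root in Client's graph, together with
-- the unclaimed edges between it and that component which are still in use.
Outsider : ℕ → Set
Outsider n = Fin n × List (Edge n)

vertex : Outsider n → Fin n
vertex = proj₁

links : Outsider n → List (Edge n)
links = proj₂

weight : Outsider n → ℕ
weight o = length (links o)

restart age : Fin n → Outsider n → Outsider n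
restart x (y , _)  = y , [ edge x y ]
age     x (y , es) = y , edge x y ∷ es

vertex-restart : (x : Fin n) (os : List (Outsider n)) → map vertex (map (restart x) os) ≡ map vertex os
vertex-restart x os = sym (map-∘ os)

vertex-age : (x : Fin n) (os : List (Outsider n)) → map vertex (map (age x) os) ≡ map vertex os
vertex-age x os = sym (map-∘ os)

vertices-after : (x : Fin n) (X Y : List (Outsider n)) →
  map vertex (map (restart x) X ++ map (age x) Y) ≡ map vertex (X ++ Y)
vertices-after x X Y = begin
  map vertex (map (restart x) X ++ map (age x) Y)
    ≡⟨ map-++ vertex (map (restart x) X) _ ⟩
  map vertex (map (restart x) X) ++ map vertex (map (age x) Y)
    ≡⟨ cong₂ _++_ (vertex-restart x X) (vertex-age x Y) ⟩
  map vertex X ++ map vertex Y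
    ≡⟨ map-++ vertex X Y ⟨
  map vertex (X ++ Y) ∎
  where open ≡-Reasoning

links-restart : (x : Fin n) (os : List (Outsider n)) →
  concatMap links (map (restart x) os) ≡ map (edge x) (map vertex os)
links-restart x []       = refl
links-restart x (o ∷ os) = cong (edge x (vertex o) ∷_) (links-restart x os)

links-age : (x : Fin n) (os : List (Outsider n)) →
  concatMap links (map (age x) os) ↭ map (edge x) (map vertex os) ++ concatMap links os
links-age x []       = ↭-refl
links-age x (o ∷ os) = prep _ (↭-trans (++⁺ˡ (links o) (links-age x os))
                                       (shifts (links o) (map (edge x) (map vertex os))))

concatMap-↭ : {A B : Set} (f : A → List B) {xs ys : List A} → xs ↭ ys → concatMap f xs ↭ concatMap f ys
concatMap-↭ f Perm.refl            = ↭-refl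
concatMap-↭ f (prep x p)           = ++⁺ˡ (f x) (concatMap-↭ f p)
concatMap-↭ f (swap x y p)         = ↭-trans (shifts (f x) (f y)) (++⁺ˡ (f y) (++⁺ˡ (f x) (concatMap-↭ f p)))
concatMap-↭ f (Perm.trans p p′)    = ↭-trans (concatMap-↭ f p) (concatMap-↭ f p′)

length≤links : {os : List (Outsider n)} → All (λ o → 1 ≤ weight o) os → length os ≤ length (concatMap links os)
length≤links []                    = z≤n
length≤links {os = o ∷ os} (1≤w ∷ 1≤ws) =
  ≤-trans (+-mono-≤ 1≤w (length≤links 1≤ws)) (≤-reflexive (sym (length-++ (links o))))

-- From Ready k, Waiter can attach the listed vertices one at a time, in this order.
Ready : ℕ → List (Outsider n) → Set
Ready t []       = ⊤
Ready t (o ∷ os) = t ≤ weight o × Ready (pred t) os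

ready-zero : (os : List (Outsider n)) → Ready 0 os
ready-zero []       = tt
ready-zero (_ ∷ os) = z≤n , ready-zero os

-- Weights and thresholds both rise by 1. At the first vertex with threshold 0, the new edge to `x`
-- alone meets the new threshold 1.
ready-age : ∀ {t} {x : Fin n} os → Ready t os → Ready (suc t) (map (age x) os)
ready-age []                   _             = tt
ready-age {t = zero}  (_ ∷ os) _             = s≤s z≤n , ready-zero _
ready-age {t = suc t} (_ ∷ os) (t<w , ready) = s≤s t<w , ready-age os ready

-- The newcomer goes right after the first `t` vertices: these have aged to meet the thresholds from
-- `suc t` down to 2, the newcomer meets 1, and nothing is asked of those behind it.
ready-insert : ∀ {t} {x : Fin n} {a} os → t ≤ length os → Ready t os → 1 ≤ weight a →
  ∃[ os′ ] os′ ↭ a ∷ map (age x) os × Ready (suc t) os′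
ready-insert {t = zero} {x} {a} os _ _ 1≤a = a ∷ map (age x) os , ↭-refl , 1≤a , ready-zero _
ready-insert {t = suc t} {x} (o ∷ os) (s≤s t≤) (t<w , ready) 1≤a
  with os′ , p , ready′ ← ready-insert os t≤ ready 1≤a
  = age x o ∷ os′ , ↭-trans (prep _ p) (swap _ _ ↭-refl) , s≤s t<w , ready′

-- Positions, and the rounds played from them.

module _ {n : ℕ} (root : Fin n) where

  -- The component of the root is not stored. What matters about a link is only that claiming it
  -- joins the outsider to the root.
  Absorbs : Graph n → Outsider n → Set
  Absorbs F o = All (λ e → Joined (e ∷ F) root (vertex o)) (links o)

  -- `junk` collects the discarded edges, which Waiter offers only after every outsider is attached.
  -- The `clique` part holds the edges between outsiders, all still unclaimed.
  record Position (F free : Graph n) (os : List (Outsider n)) : Set where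
    field
      junk      : Graph n
      unclaimed : free ↭ concatMap links os ++ clique (map vertex os) ++ junk
      absorbs   : All (Absorbs F) os
      covers    : ∀ v → v ∈ map vertex os ⊎ Joined F root v

  Position-↭ : ∀ {F free os os′} → os ↭ os′ → Position F free os → Position F free os′
  Position-↭ p pos = record
    { junk      = junk
    ; unclaimed = ↭-trans unclaimed
                    (++⁺ (concatMap-↭ links p) (++⁺ʳ junk (clique-↭ (↭-map⁺ vertex p))))
    ; absorbs   = All-resp-↭ p absorbs
    ; covers    = λ v → Sum.map₁ (∈-resp-↭ (↭-map⁺ vertex p)) (covers v)
    }
    where open Position pos

  -- The star of `vertex o` leaves the clique: its edges to `X` become the sole links of the
  -- restarted vertices, and its edges to `Y` join the old links there. Old links still absorb,
  -- because Client's graph only grows.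
  after-choice : ∀ {F free rest wasted e o} X Y (pos : Position F free (o ∷ X ++ Y)) → e ∈ links o →
    rest ↭ wasted ++ concatMap links Y ++ clique (map vertex (o ∷ X ++ Y)) ++ Position.junk pos →
    Position (e ∷ F) rest (map (restart (vertex o)) X ++ map (age (vertex o)) Y)
  after-choice {F} {free} {rest} {wasted} {e} {o} X Y pos e∈o rest↭ = record
    { junk      = wasted ++ junk
    ; unclaimed = unclaimed′
    ; absorbs   = All.++⁺ (All.map⁺ (All.universal (λ y → link (vertex y) ∷ []) X))
                          (All.map⁺ (All.map (λ {y} abs → link (vertex y) ∷ All.map older abs)
                                             (All.++⁻ʳ X (All.tail absorbs))))
    ; covers    = covers′
    }
    where
    open Position pos
    x = vertex o
    joined : Joined (e ∷ F) root x
    joined = All.lookup (All.head absorbs) e∈o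
    link : ∀ y → Joined (edge x y ∷ e ∷ F) root y
    link y = Joined-mono there joined ◅◅ edge-joins x y (here refl)
    older : ∀ {y e′} → Joined (e′ ∷ F) root y → Joined (e′ ∷ e ∷ F) root y
    older = Joined-mono λ { (here refl) → here refl ; (there f∈F) → there (there f∈F) }
    covers′ : ∀ v → v ∈ map vertex (map (restart x) X ++ map (age x) Y) ⊎ Joined (e ∷ F) root v
    covers′ v with covers v
    ... | inj₁ (here refl)  = inj₂ joined
    ... | inj₁ (there v∈)   = inj₁ (subst (v ∈_) (sym (vertices-after x X Y)) v∈)
    ... | inj₂ reached      = inj₂ (Joined-mono there reached)
    unclaimed′ : rest ↭ concatMap links (map (restart x) X ++ map (age x) Y)
                      ++ clique (map vertex (map (restart x) X ++ map (age x) Y)) ++ wasted ++ junk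
    unclaimed′ = begin
      rest
        ↭⟨ rest↭ ⟩
      wasted ++ concatMap links Y ++ (map (edge x) (map vertex (X ++ Y)) ++ others) ++ junk
        ≡⟨ cong (λ l → wasted ++ concatMap links Y ++ (l ++ others) ++ junk)
             (trans (cong (map (edge x)) (map-++ vertex X Y)) (map-++ (edge x) (map vertex X) _)) ⟩
      wasted ++ concatMap links Y ++ ((toX ++ toY) ++ others) ++ junk
        ↭⟨ solve 6
             (λ w l a b c j → (w ⊕ (l ⊕ (((a ⊕ b) ⊕ c) ⊕ j))) ⊜ ((a ⊕ (b ⊕ l)) ⊕ (c ⊕ (w ⊕ j))))
             ↭-refl wasted (concatMap links Y) toX toY others junk ⟩
      (toX ++ toY ++ concatMap links Y) ++ others ++ wasted ++ junk
        ↭⟨ ++⁺ʳ _ (++⁺ (↭-reflexive (sym (links-restart x X))) (↭-sym (links-age x Y))) ⟩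
      (concatMap links (map (restart x) X) ++ concatMap links (map (age x) Y)) ++ others ++ wasted ++ junk
        ≡⟨ cong₂ (λ l vs → l ++ clique vs ++ wasted ++ junk)
             (sym (concatMap-++ links (map (restart x) X) (map (age x) Y)))
             (sym (vertices-after x X Y)) ⟩
      concatMap links (map (restart x) X ++ map (age x) Y)
        ++ clique (map vertex (map (restart x) X ++ map (age x) Y)) ++ wasted ++ junk ∎
      where
      open PermutationReasoning
      open CommutativeMonoidSolver (++-commutativeMonoid {A = Edge n}) using (solve; _⊕_; _⊜_)
      toX    = map (edge x) (map vertex X)
      toY    = map (edge x) (map vertex Y)
      others = clique (map vertex (X ++ Y))

  -- One round. The continuation learns only how many vertices of `X` remain, so it has to cope with
  -- every choice of Client alike.
  advance : ∀ {q F free} X Y → Position F free (X ++ Y) → suc q ≤ length (concatMap links X) →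
    (∀ {x X′ F′ rest} → length X ≡ suc (length X′) →
      Position F′ rest (map (restart x) X′ ++ map (age x) Y) → Wins q F′ rest) →
    Wins q F free
  advance {q} {F} {free} X Y pos enough continue =
    offer-forces offered rest (trans (length-take (suc q) (concatMap links X)) (m≤n⇒m⊓n≡m enough)) split next
    where
    open Position pos
    offered = take (suc q) (concatMap links X)
    wasted  = drop (suc q) (concatMap links X)
    tail    = clique (map vertex (X ++ Y)) ++ junk
    rest    = wasted ++ concatMap links Y ++ tail
    X-links : offered ++ wasted ≡ concatMap links X
    X-links = take++drop≡id (suc q) (concatMap links X)
    split : free ↭ offered ++ rest
    split = begin
      free                                              ↭⟨ unclaimed ⟩
      concatMap links (X ++ Y) ++ tail                  ≡⟨ cong (_++ tail) (concatMap-++ links X Y) ⟩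
      (concatMap links X ++ concatMap links Y) ++ tail  ≡⟨ ++-assoc (concatMap links X) _ _ ⟩
      concatMap links X ++ concatMap links Y ++ tail    ≡⟨ cong (_++ concatMap links Y ++ tail) X-links ⟨
      (offered ++ wasted) ++ concatMap links Y ++ tail  ≡⟨ ++-assoc offered wasted _ ⟩
      offered ++ rest                                   ∎
      where open PermutationReasoning
    next : ∀ {e} → e ∈ offered → Forces q rest (λ G → Connected (e ∷ G ++ F))
    next {e} e∈offered
      -- Whichever edge Client takes, it is a link of some `o` in `X`; a permutation brings this `o`
      -- to the front.
      with o , o∈X , e∈o ← find (∈-concatMap⁻ links (subst (e ∈_) X-links (∈-++⁺ˡ e∈offered)))
      with us , vs , X≡ ← ∈-∃++ o∈X
      = respond (us ++ vs) (↭-trans (↭-reflexive X≡) (shift o us vs)) e∈o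
      where
      respond : ∀ {o} X′ → X ↭ o ∷ X′ → e ∈ links o → Forces q rest (λ G → Connected (e ∷ G ++ F))
      respond X′ p e∈o = Product.map₂
        -- The edge `e` moves from the claims of the remaining play into the graph Client already
        -- has.
        (λ wins {G} play u v → Joined-mono (∈-resp-↭ (shift e G F)) (wins play u v))
        (continue (↭-length p)
          (after-choice {wasted = wasted} X′ Y (Position-↭ (++⁺ʳ Y p) pos) e∈o
            (++⁺ˡ wasted (++⁺ˡ (concatMap links Y)
              (++⁺ʳ junk (clique-↭ (↭-map⁺ vertex (++⁺ʳ Y p))))))))

  -- Here `X` is a single vertex, so nothing is restarted: the head leaves and the others age, which
  -- lifts `Ready q` of the tail back to `Ready (suc q)`. Ageing rebuilds the list, hence the
  -- recursion on its length. With no outsider left, `covers` joins every vertex to the root.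
  finish : ∀ {q F free} m os → length os ≡ m → Ready (suc q) os → Position F free os → Wins q F free
  finish {q} {F} {free} zero [] _ _ pos =
    some-strategy q free , λ {G} _ u v → Joined-mono (∈-++⁺ʳ G) (EqC.symmetric _ (reach u) ◅◅ reach v)
    where
    reach : ∀ v → Joined F root v
    reach v with inj₂ reached ← Position.covers pos v = reached
  finish (suc m) (o ∷ os) |os| (k≤w , ready) pos =
    advance [ o ] os pos (≤-trans k≤w (≤-reflexive (cong length (sym (++-identityʳ (links o))))))
      λ { {X′ = []} _ pos′ → finish m _ (trans (length-map _ os) (suc-injective |os|)) (ready-age os ready) pos′ }

  -- Round t + 1, with k = t + 1 + j: the vertices of weight t + 1 are c ∷ C, those of
  -- weight 1 are A, and os consists of the chain and of the vertices left to the end.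
  develop : ∀ {q F free} j t {c A C os} → q ≡ t + j → length A ≡ j → length C ≡ j →
    All (λ o → 1 ≤ weight o) A → All (λ o → suc t ≤ weight o) (c ∷ C) →
    t ≤ length os → Ready t os →
    Position F free ((c ∷ A) ++ C ++ os) → Wins q F free
  -- Now `suc t` is k, and `c` becomes the head of the completed chain.
  develop zero t {A = []} {[]} {os} refl _ _ _ (t<c ∷ _) _ ready pos
    rewrite +-identityʳ t = finish _ _ refl (t<c , ready) pos
  develop {q} (suc j) t {c} {A} {c₁ ∷ C} {os} q≡ |A| |C| 1≤A (t<c ∷ t<C) t≤ ready pos =
    advance (c ∷ A) ((c₁ ∷ C) ++ os) pos heavy continue
    where
    -- The weights add up to at least k: `suc t` from `c`, and 1 from each of the `suc j` vertices
    -- of `A`.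
    heavy : suc q ≤ length (links c ++ concatMap links A)
    heavy = begin
      suc q                                        ≡⟨ cong suc q≡ ⟩
      suc t + suc j                                ≡⟨ cong (suc t +_) |A| ⟨
      suc t + length A                             ≤⟨ +-mono-≤ t<c (length≤links 1≤A) ⟩
      weight c + length (concatMap links A)        ≡⟨ length-++ (links c) ⟨
      length (links c ++ concatMap links A)        ∎
      where open ≤-Reasoning
    continue : ∀ {x X′ F′ rest} → suc (length A) ≡ suc (length X′) →
      Position F′ rest (map (restart x) X′ ++ map (age x) ((c₁ ∷ C) ++ os)) → Wins q F′ rest
    continue {X′ = []} |X′| _ with () ← trans (sym |A|) (suc-injective |X′|)
    -- Of the `suc j` restarted vertices, `a` extends the chain and the other `j` form the next `A`.
    -- The aged `c₁` and `C` provide the vertices of weight `suc (suc t)`.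
    continue {x} {a ∷ A′} |X′| pos′
      with os′ , p , ready′ ← ready-insert {x = x} {a = restart x a} os t≤ ready ≤-refl
      = develop j (suc t) (trans q≡ (+-suc t j))
          (trans (length-map _ A′) (suc-injective (trans (sym (suc-injective |X′|)) |A|)))
          (trans (length-map _ C) (suc-injective |C|))
          (All.map⁺ (All.universal (λ _ → ≤-refl) A′))
          (All.map⁺ (All.map s≤s t<C))
          (≤-trans (s≤s (≤-trans t≤ (≤-reflexive (sym (length-map _ os))))) (≤-reflexive (sym (↭-length p))))
          ready′
          (Position-↭ regroup pos′)
      where
      regroup : map (restart x) (a ∷ A′) ++ map (age x) ((c₁ ∷ C) ++ os) ↭
                (age x c₁ ∷ map (restart x) A′) ++ map (age x) C ++ os′
      regroup = begin
        restart x a ∷ map (restart x) A′ ++ age x c₁ ∷ map (age x) (C ++ os)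
          ≡⟨ cong (λ l → restart x a ∷ map (restart x) A′ ++ age x c₁ ∷ l) (map-++ (age x) C os) ⟩
        restart x a ∷ map (restart x) A′ ++ age x c₁ ∷ map (age x) C ++ map (age x) os
          ↭⟨ solve 5
               (λ a A c C o → (a ⊕ (A ⊕ (c ⊕ (C ⊕ o)))) ⊜ ((c ⊕ A) ⊕ (C ⊕ (a ⊕ o))))
               ↭-refl [ restart x a ] (map (restart x) A′) [ age x c₁ ] (map (age x) C) (map (age x) os) ⟩
        (age x c₁ ∷ map (restart x) A′) ++ map (age x) C ++ restart x a ∷ map (age x) os
          ↭⟨ ++⁺ˡ (age x c₁ ∷ map (restart x) A′) (++⁺ˡ (map (age x) C) (↭-sym p)) ⟩
        (age x c₁ ∷ map (restart x) A′) ++ map (age x) C ++ os′ ∎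
        where
        open PermutationReasoning
        open CommutativeMonoidSolver (++-commutativeMonoid {A = Outsider n}) using (solve; _⊕_; _⊜_)

-- The starting position and Waiter's win.

-- The first row of the clique consists of the edges at the root, one per outsider, so the opening
-- position looks as if all outsiders had just been restarted at the root.
initial : ∀ m → Position zero [] (K (suc m)) (map (restart zero) (map (_, []) (tabulate suc)))
initial m = record
  { junk      = []
  ; unclaimed = ↭-reflexive unclaimed
  ; absorbs   = All.map⁺ (All.universal (λ o → edge-joins zero (vertex o) (here refl) ∷ []) _)
  ; covers    = λ { zero    → inj₂ ε
                  ; (suc v) → inj₁ (subst (suc v ∈_) (sym names) (∈-tabulate⁺ v)) }
  }
  where
  open ≡-Reasoning
  outside = map (_, []) (tabulate {n = m} suc)
  bare : map vertex outside ≡ tabulate suc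
  bare = trans (sym (map-∘ (tabulate suc))) (map-id (tabulate suc))
  names : map vertex (map (restart zero) outside) ≡ tabulate suc
  names = trans (vertex-restart zero outside) bare
  unclaimed : K (suc m) ≡ concatMap links (map (restart zero) outside)
                        ++ clique (map vertex (map (restart zero) outside)) ++ []
  unclaimed = begin
    K (suc m)
      ≡⟨ K≡clique (suc m) ⟩
    map (edge zero) (tabulate suc) ++ clique (tabulate suc)
      ≡⟨ cong₂ (λ vs ws → map (edge zero) vs ++ clique ws) bare names ⟨
    map (edge zero) (map vertex outside) ++ clique (map vertex (map (restart zero) outside))
      ≡⟨ cong₂ _++_ (links-restart zero outside) (++-identityʳ _) ⟨
    concatMap links (map (restart zero) outside) ++ clique (map vertex (map (restart zero) outside)) ++ [] ∎

2k≤n⇒forces : ∀ {q} m → 2 * suc q ≤ suc (suc m) → WaiterCanForce (suc (suc m)) q Connected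
2k≤n⇒forces {q} m 2k≤n with initial (suc m)
... | pos = Product.map₂ (λ wins {G} p → subst Connected (++-identityʳ G) (wins p))
    -- At first every weight is 1 and the chain is empty. The vertices `c`, `A` and `C` number 1 +
    -- 2q = 2k - 1, which is at most n - 1; the rest wait until the end.
    (develop zero q 0 {c} {take q os} {take q (drop q os)} {drop q (drop q os)}
      refl |A| |C| (All.take⁺ q 1≤os) (≤-refl ∷ All.take⁺ q (All.drop⁺ q 1≤os)) z≤n (ready-zero _)
      (subst (Position zero [] (K (suc (suc m))) ∘ (c ∷_)) regroup pos))
  where
  others : List (Fin (suc (suc m)))
  others = tabulate (λ v → suc (suc v))
  c : Outsider (suc (suc m))
  c = restart zero (suc zero , [])
  os : List (Outsider (suc (suc m)))
  os = map (restart zero) (map (_, []) others)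
  |os| : length os ≡ m
  |os| = trans (length-map (restart zero) (map (_, []) others))
         (trans (length-map (_, []) others) (length-tabulate _))
  1≤os : All (λ o → 1 ≤ weight o) os
  1≤os = All.map⁺ (All.universal (λ _ → ≤-refl) _)
  q+q≤m : q + q ≤ m
  q+q≤m = ≤-pred (≤-pred (≤-trans (≤-reflexive (sym lemma)) 2k≤n))
    where
    lemma : 2 * suc q ≡ suc (suc (q + q))
    lemma = cong suc (trans (cong (q +_) (+-identityʳ (suc q))) (+-suc q q))
  |A| : length (take q os) ≡ q
  |A| = trans (length-take q os) (m≤n⇒m⊓n≡m (≤-trans (m+n≤o⇒m≤o q q+q≤m) (≤-reflexive (sym |os|))))
  |C| : length (take q (drop q os)) ≡ q
  |C| = trans (length-take q (drop q os)) (m≤n⇒m⊓n≡m (≤-trans (m+n≤o⇒m≤o∸n q q+q≤m)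
          (≤-reflexive (sym (trans (length-drop q os) (cong (_∸ q) |os|))))))
  regroup : os ≡ take q os ++ take q (drop q os) ++ drop q (drop q os)
  regroup = sym (trans (cong (take q os ++_) (take++drop≡id q (drop q os))) (take++drop≡id q os))

-- Comparing 2k with n and k with the floor of n/2.

2*suc≤⇒≤⌊/2⌋ : ∀ {q n} → 2 * suc q ≤ n → suc q ≤ ⌊ n /2⌋
2*suc≤⇒≤⌊/2⌋ {q} {n} 2k≤n = begin
  suc q                     ≡⟨ n≡⌊n+n/2⌋ (suc q) ⟩
  ⌊ suc q + suc q /2⌋       ≡⟨ cong (λ l → ⌊ suc q + l /2⌋) (+-identityʳ (suc q)) ⟨
  ⌊ 2 * suc q /2⌋           ≤⟨ ⌊n/2⌋-mono 2k≤n ⟩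
  ⌊ n /2⌋                   ∎
  where open ≤-Reasoning

≤⌊/2⌋⇒2*≤ : ∀ {k n} → k ≤ ⌊ n /2⌋ → 2 * k ≤ n
≤⌊/2⌋⇒2*≤ {k} {n} k≤ = begin
  2 * k                ≡⟨ cong (k +_) (+-identityʳ k) ⟩
  k + k                ≤⟨ +-mono-≤ k≤ (≤-trans k≤ (⌊n/2⌋≤⌈n/2⌉ n)) ⟩
  ⌊ n /2⌋ + ⌈ n /2⌉    ≡⟨ ⌊n/2⌋+⌈n/2⌉≡n n ⟩
  n                    ∎
  where open ≤-Reasoning

theorem1p3 : (n q : ℕ) → 4 ≤ n → 1 ≤ q →
    WaiterCanForce n q Connected ⇔ q ≤ ⌊ n /2⌋ ∸ 1
theorem1p3 (suc zero) _ (s≤s ()) _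
theorem1p3 (suc (suc m)) q _ _ = mk⇔
  -- For n = `suc (suc m)` the floor of n/2 computes to a successor, so the truncated subtraction of
  -- 1 is exact and shifts between k and `q`.
  (λ force → ≤-pred (2*suc≤⇒≤⌊/2⌋ (connected⇒2k≤n m force)))
  (λ q≤ → 2k≤n⇒forces m (≤⌊/2⌋⇒2*≤ (s≤s q≤)))
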